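{- For integers $k \ge 1$, $w_k \ge 0$ and $n \ge 1$, there is an $O(k \log k \log n + w_k)$-bit adjacency labeling scheme for the family of all $w_k$-probe $\mathcal{C}_k$-graphs on a vertex set of size $n$, where $\mathcal{C}_k$ is the family of graphs of clique-width at most $k$. That is, there is an absolute constant $C>0$ such that for all $k, w_k, n$ this family has an $L$-bit adjacency labeling scheme with $L \le C\,(k \log_2 k \,\log_2 n + w_k)$.
   Context: All graphs are finite, undirected, without self-loops or parallel edges. For a graph $G=(V,E)$ and $u,v \in V$, put $\mathsf{adj}(u,v) = 1$ if $\{u,v\}\in E$ and $\mathsf{adj}(u,v)=0$ otherwise. Adjacency labeling scheme: let $\mathcal{F}_n$ be a family of graphs on the vertex set $V$, $|V| = n$. An $L$-bit adjacency labeling scheme of $\mathcal{F}_n$ is a pair of functions $\mathsf{enc}: \mathcal{F}_n \to (V \to \{0,1\}^L)$ and $\mathsf{dec}: \{0,1\}^L \times \{0,1\}^L \to \{0,1\}$ such that for all $G = (V,E)\in \mathcal{F}_n$ and all $u,v\in V$, $\mathsf{adj}(u,v) = \mathsf{dec}(\mathsf{enc}(G)(u), \mathsf{enc}(G)(v))$. (So $\mathsf{dec}$ may depend on the family, but not on the individual graph $G$.) Clique-width: the clique-width of a graph $G$ is the minimum number of vertex labels needed to construct $G$ using the following four operations on vertex-labeled graphs: (1) create a single vertex $v$ with label $i$; (2) disjoint union $G_1 \oplus G_2$ of two labeled graphs; (3) join $\eta_{i,j}$ with $i\neq j$, which adds an edge between every pair of vertices one of which has label $i$ and the other label $j$; (4)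 relabel $\rho_{i\to j}$, which changes the label of all vertices with label $i$ to label $j$. $\mathcal{F}$-width and probe graphs: let $\mathcal{F}$ be a family of graphs. The $\mathcal{F}$-width of a graph $G=(V,E)$ is the minimum number $w$ of independent sets $N_1,\ldots,N_w$ in $G$ such that there exists $H=(V,E')\in\mathcal{F}$ for which (1) $G$ is a spanning subgraph of $H$ (i.e. $E\subseteq E'$), and (2) for every edge $\{u,v\}\in E'\setminus E$ there exists $i\in\{1,\ldots,w\}$ with $u,v\in N_i$. A graph whose $\mathcal{F}$-width is $w$ is called a $w$-probe $\mathcal{F}$-graph. -}

module Defs where

open import Data.Bool using (Bool; true; false; _∧_; _∨_; if_then_else_)
open import Data.Bool.Properties using (∨-comm; ∧-comm)
open import Data.Fin using (Fin; _≟_)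
open import Data.Fin.Subset using (Subset; _∈_)
open import Data.Nat using (ℕ; _+_; _*_; _^_; _≤_)
open import Data.Product using (Σ-syntax; ∃-syntax; _×_)
open import Data.Sum using (_⊎_; inj₁; inj₂)
open import Data.Unit using (⊤)
open import Data.Vec using (Vec)
open import Function.Bundles using (_↔_; Inverse)
open import Relation.Nullary using (yes; no; does; contradiction)
open import Relation.Binary.PropositionalEquality
  using (_≡_; _≢_; refl; sym; trans; cong₂)

record Graph (V : Set) : Set where
  field
    adj        : V → V → Bool
    adj-sym    : ∀ u v → adj u v ≡ adj v u
    adj-irrefl : ∀ v → adj v v ≡ false

open Graph public

_≅_ : {V W : Set} → Graph V → Graph W → Set
_≅_ {V} {W} G H =
  Σ[ f ∈ V ↔ W ] (∀ u v → adj H (Inverse.to f u) (Inverse.to f v) ≡ adj G u v)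

GraphFamily : Set₁
GraphFamily = ∀ n → Graph (Fin n) → Set

IsMinimum : (ℕ → Set) → ℕ → Set
IsMinimum P m = P m × (∀ j → P j → m ≤ j)

-- The membership argument of enc is irrelevant: a label may depend on the
-- graph, but not on how its membership in the family is witnessed.
record AdjacencyLabelingScheme (L n : ℕ) (F : Graph (Fin n) → Set) : Set where
  field
    enc     : (G : Graph (Fin n)) → .(F G) → Fin n → Vec Bool L
    dec     : Vec Bool L → Vec Bool L → Bool
    correct : ∀ G (G∈F : F G) u v → adj G u v ≡ dec (enc G G∈F u) (enc G G∈F v)

record LabeledGraph (k : ℕ) (V : Set) : Set where
  field
    graph : Graph V
    label : V → Fin k

  hasLabel : Fin k → V → Bool
  hasLabel i v = does (label v ≟ i)

open LabeledGraph public

module _ {k : ℕ} where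

  singleton : Fin k → LabeledGraph k ⊤
  singleton i .graph .adj _ _      = false
  singleton i .graph .adj-sym _ _  = refl
  singleton i .graph .adj-irrefl _ = refl
  singleton i .label _             = i

  disjointUnion : ∀ {V W} → LabeledGraph k V → LabeledGraph k W →
                  LabeledGraph k (V ⊎ W)
  disjointUnion G H .graph .adj (inj₁ u) (inj₁ v)     = adj (graph G) u v
  disjointUnion G H .graph .adj (inj₂ u) (inj₂ v)     = adj (graph H) u v
  disjointUnion G H .graph .adj (inj₁ _) (inj₂ _)     = false
  disjointUnion G H .graph .adj (inj₂ _) (inj₁ _)     = false
  disjointUnion G H .graph .adj-sym (inj₁ u) (inj₁ v) = adj-sym (graph G) u v
  disjointUnion G H .graph .adj-sym (inj₂ u) (inj₂ v) = adj-sym (graph H) u v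
  disjointUnion G H .graph .adj-sym (inj₁ _) (inj₂ _) = refl
  disjointUnion G H .graph .adj-sym (inj₂ _) (inj₁ _) = refl
  disjointUnion G H .graph .adj-irrefl (inj₁ v)       = adj-irrefl (graph G) v
  disjointUnion G H .graph .adj-irrefl (inj₂ v)       = adj-irrefl (graph H) v
  disjointUnion G H .label (inj₁ v)                   = label G v
  disjointUnion G H .label (inj₂ v)                   = label H v

  joined : ∀ {V} → Fin k → Fin k → LabeledGraph k V → V → V → Bool
  joined i j G u v =
    (hasLabel G i u ∧ hasLabel G j v) ∨ (hasLabel G j u ∧ hasLabel G i v)

  joined-sym : ∀ {V} i j (G : LabeledGraph k V) u v →
               joined i j G u v ≡ joined i j G v u
  joined-sym i j G u v = trans
    (∨-comm (hasLabel G i u ∧ hasLabel G j v) _)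
    (cong₂ _∨_ (∧-comm (hasLabel G j u) _) (∧-comm (hasLabel G i u) _))

  joined-irrefl : ∀ {V} i j → i ≢ j → (G : LabeledGraph k V) → ∀ v →
                  joined i j G v v ≡ false
  joined-irrefl i j i≢j G v with label G v ≟ i | label G v ≟ j
  ... | yes p | yes q = contradiction (trans (sym p) q) i≢j
  ... | yes _ | no  _ = refl
  ... | no  _ | yes _ = refl
  ... | no  _ | no  _ = refl

  join : ∀ {V} (i j : Fin k) → i ≢ j → LabeledGraph k V → LabeledGraph k V
  join i j i≢j G .graph .adj u v      = adj (graph G) u v ∨ joined i j G u v
  join i j i≢j G .graph .adj-sym u v  =
    cong₂ _∨_ (adj-sym (graph G) u v) (joined-sym i j G u v)
  join i j i≢j G .graph .adj-irrefl v =
    cong₂ _∨_ (adj-irrefl (graph G) v) (joined-irrefl i j i≢j G v)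
  join i j i≢j G .label               = label G

  relabel : ∀ {V} → Fin k → Fin k → LabeledGraph k V → LabeledGraph k V
  relabel i j G .graph   = graph G
  relabel i j G .label v = if hasLabel G i v then j else label G v

data Expr (k : ℕ) : Set where
  vertex : Fin k → Expr k
  _⊕_    : Expr k → Expr k → Expr k
  η      : (i j : Fin k) → i ≢ j → Expr k → Expr k
  ρ      : (i j : Fin k) → Expr k → Expr k

Vertices : ∀ {k} → Expr k → Set
Vertices (vertex _)  = ⊤
Vertices (e₁ ⊕ e₂)   = Vertices e₁ ⊎ Vertices e₂
Vertices (η _ _ _ e) = Vertices e
Vertices (ρ _ _ e)   = Vertices e

⟦_⟧ : ∀ {k} (e : Expr k) → LabeledGraph k (Vertices e)
⟦ vertex i ⟧    = singleton i
⟦ e₁ ⊕ e₂ ⟧     = disjointUnion ⟦ e₁ ⟧ ⟦ e₂ ⟧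
⟦ η i j i≢j e ⟧ = join i j i≢j ⟦ e ⟧
⟦ ρ i j e ⟧     = relabel i j ⟦ e ⟧

ConstructibleWith : ∀ {n} → Graph (Fin n) → ℕ → Set
ConstructibleWith G k = Σ[ e ∈ Expr k ] (G ≅ graph ⟦ e ⟧)

HasCliqueWidth : ∀ {n} → Graph (Fin n) → ℕ → Set
HasCliqueWidth G = IsMinimum (ConstructibleWith G)

CliqueWidthAtMost : ℕ → GraphFamily
CliqueWidthAtMost k n G = ∃[ c ] (HasCliqueWidth G c × c ≤ k)

Independent : ∀ {n} → Graph (Fin n) → Subset n → Set
Independent G S = ∀ u v → u ∈ S → v ∈ S → adj G u v ≡ false

record ProbeWitness (F : GraphFamily) {n} (G : Graph (Fin n)) (w : ℕ) : Set where
  field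
    N           : Fin w → Subset n
    independent : ∀ i → Independent G (N i)
    H           : Graph (Fin n)
    H∈F         : F n H
    subgraph    : ∀ u v → adj G u v ≡ true → adj H u v ≡ true
    covered     : ∀ u v → adj H u v ≡ true → adj G u v ≡ false →
                  ∃[ i ] (u ∈ N i × v ∈ N i)

HasWidth : GraphFamily → ∀ {n} → Graph (Fin n) → ℕ → Set
HasWidth F G = IsMinimum (ProbeWitness F G)

ProbeGraph : ℕ → GraphFamily → GraphFamily
ProbeGraph w F n G = HasWidth F G w

-- p / q is a rational upper bound of the real number log₂ m.
Log₂≤ : (m p q : ℕ) → Set
Log₂≤ m p q = 1 ≤ q × m ^ q ≤ 2 ^ p

-- For k, n ≥ 1 this is exactly the real inequality
--   L ≤ C (k log₂ k log₂ n + w):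
-- both logarithms are nonnegative, so the right-hand side is the infimum of
-- C (k (p / q) (r / s) + w) over all rational upper bounds p / q of log₂ k
-- and r / s of log₂ n.  Denominators are cleared by multiplying with q s.
SizeBound : (C k n w L : ℕ) → Set
SizeBound C k n w L = ∀ p q r s → Log₂≤ k p q → Log₂≤ n r s →
  L * (q * s) ≤ C * (k * (p * r) + w * (q * s))

-- A balanced cut of the clique-width expression splits the vertices so that
-- each side has at most 2/3 of them and adjacency across the cut depends, on
-- the inner side, only on one of k classes.  One cut thus costs a side bit and
-- k further bits per vertex: the indicator of its class inside, the list of
-- classes adjacent to it outside.  Iterating O(log n) times labels H, and w
-- more bits record membership in the sets Nᵢ.

module Submission where

open import Data.Bool using (Bool; true; false; not; _∧_; _∨_; if_then_else_)
import Data.Bool as Bool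
import Data.Bool.Properties as Bool
open import Data.Fin using (Fin; zero; suc; _≟_; inject≤)
open import Data.Fin.Permutation using (↔⇒≡)
open import Data.Fin.Properties using (all?; 1↔⊤; +↔⊎)
open import Data.Fin.Subset using (Subset; ⁅_⁆; _∩_; _∈_)
open import Data.Fin.Subset.Properties
  using (anySubset?; nonempty?; ∩-comm; x∈p∩q⁺; x∈p∩q⁻; x∈⁅x⁆; x∈⁅y⁆⇒x≡y)
open import Data.Nat
  using (ℕ; zero; suc; _+_; _*_; _^_; _≤_; _<_; z≤n; s≤s; _≤?_; _<?_; >-nonZero)
open import Data.Nat.Properties
  using (module ≤-Reasoning; ≤-refl; ≤-reflexive; ≤-trans; ≤-total; ≤-pred; n≤1+n;
         <⇒≤; <⇒≱; ≮⇒≥; ≰⇒>; m≤m+n; m≤n+m; +-comm; +-identityʳ; +-mono-≤;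
         +-monoˡ-≤; +-monoʳ-≤; +-cancelˡ-≤; *-assoc; *-identityʳ; *-mono-≤;
         *-monoˡ-≤; *-monoʳ-≤; *-monoˡ-<; *-cancelˡ-≤; ^-monoˡ-≤; ^-monoʳ-<; ^-*-assoc)
open import Data.Nat.Tactic.RingSolver using (solve-∀)
open import Data.Product using (Σ-syntax; ∃-syntax; _×_; _,_; proj₁; proj₂)
open import Data.Sum using (_⊎_; inj₁; inj₂)
open import Data.Sum.Function.Propositional using (_⊎-↔_)
open import Data.Unit using (tt)
open import Data.Vec
  using (Vec; []; _∷_; _++_; take; drop; lookup; tabulate; replicate; padRight)
open import Data.Vec.Properties
  using (lookup∘tabulate; lookup-truncate; truncate-padRight; []=⇒lookup; lookup⇒[]=)
open import Function using (_∘_; const)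
open import Function.Bundles using (_↔_; Inverse)
open import Function.Construct.Composition using (_↔-∘_)
open import Function.Construct.Symmetry using (↔-sym)
open import Relation.Nullary
  using (Dec; yes; no; does; map′; recompute; contradiction)
open import Relation.Nullary.Decidable using (dec-true; dec-false)
open import Relation.Unary using (Decidable)
open import Relation.Binary.PropositionalEquality
open import Defs

-- Arithmetic of thirds.

-- Half of a weight above two thirds of `s` is at least one third of `s`.
heavier-third : ∀ s a b → b ≤ a → 2 * s < 3 * (a + b) → s ≤ 3 * a
heavier-third s a b b≤a 2s< = *-cancelˡ-≤ 2 (≤-trans (<⇒≤ 2s<) (begin
  3 * (a + b) ≤⟨ *-monoʳ-≤ 3 (+-monoʳ-≤ a b≤a) ⟩
  3 * (a + a) ≡⟨ double a ⟩
  2 * (3 * a) ∎))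
  where
  open ≤-Reasoning
  double : ∀ a → 3 * (a + a) ≡ 2 * (3 * a)
  double = solve-∀

-- The invariant of the recursion, `s` at most (3/2)^D, survives giving up one level in exchange for
-- a third of the weight.
two-thirds-power : ∀ a s D → 3 * a ≤ 2 * s → s * 2 ^ suc D ≤ 3 ^ suc D → a * 2 ^ D ≤ 3 ^ D
two-thirds-power a s D 3a≤2s bound = *-cancelˡ-≤ 3 (begin
  3 * (a * 2 ^ D)   ≡⟨ *-assoc 3 a (2 ^ D) ⟨
  3 * a * 2 ^ D     ≤⟨ *-monoˡ-≤ (2 ^ D) 3a≤2s ⟩
  2 * s * 2 ^ D     ≡⟨ rearrange s (2 ^ D) ⟩
  s * (2 * 2 ^ D)   ≤⟨ bound ⟩
  3 * 3 ^ D         ∎)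
  where
  open ≤-Reasoning
  rearrange : ∀ s x → 2 * s * x ≡ s * (2 * x)
  rearrange = solve-∀

remaining-two-thirds : ∀ a b s → a + b ≡ s → s ≤ 3 * a → 3 * b ≤ 2 * s
remaining-two-thirds a b s refl s≤3a = +-cancelˡ-≤ (a + b) _ _ (begin
  (a + b) + 3 * b       ≤⟨ +-monoˡ-≤ (3 * b) s≤3a ⟩
  3 * a + 3 * b         ≡⟨ rearrange a b ⟩
  (a + b) + 2 * (a + b) ∎)
  where
  open ≤-Reasoning
  rearrange : ∀ a b → 3 * a + 3 * b ≡ (a + b) + 2 * (a + b)
  rearrange = solve-∀

-- Cuts of a clique-width expression.

-- Classes are the labels at the subexpression where the cut is made. Later relabelings may give
-- several classes one label, so `classLabel` tracks the current label of each class separately.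
record Cut {k} (e : Expr k) : Set where
  field
    inside      : Vertices e → Bool
    class       : Vertices e → Fin k
    classLabel  : Fin k → Fin k
    profile     : Fin k → Vertices e → Bool
    label-class : ∀ a → inside a ≡ true → label ⟦ e ⟧ a ≡ classLabel (class a)
    adj-profile : ∀ a b → inside a ≡ true → inside b ≡ false →
                  adj (graph ⟦ e ⟧) a b ≡ profile (class a) b

open Cut

module _ {k : ℕ} where

  -- The starting point: with no vertex outside, the profile is vacuous. The constructors above `e`
  -- then extend this cut upwards.
  whole : (e : Expr k) → Cut e
  whole e .inside _              = true
  whole e .class                 = label ⟦ e ⟧
  whole e .classLabel i          = i
  whole e .profile _ _           = false
  whole e .label-class _ _       = refl
  whole e .adj-profile _ _ _ ()

  cut-⊕ˡ : ∀ {e₁ : Expr k} e₂ → Cut e₁ → Cut (e₁ ⊕ e₂)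
  cut-⊕ˡ e₂ X .inside (inj₁ v)                     = inside X v
  cut-⊕ˡ e₂ X .inside (inj₂ v)                     = false
  cut-⊕ˡ e₂ X .class (inj₁ v)                      = class X v
  -- A placeholder, as classes are constrained only inside; the label is an element of `Fin k` at
  -- hand.
  cut-⊕ˡ e₂ X .class (inj₂ v)                      = label ⟦ e₂ ⟧ v
  cut-⊕ˡ e₂ X .classLabel                          = classLabel X
  cut-⊕ˡ e₂ X .profile i (inj₁ v)                  = profile X i v
  cut-⊕ˡ e₂ X .profile i (inj₂ v)                  = false
  cut-⊕ˡ e₂ X .label-class (inj₁ a)                = label-class X a
  cut-⊕ˡ e₂ X .label-class (inj₂ a) ()
  cut-⊕ˡ e₂ X .adj-profile (inj₁ a) (inj₁ b)       = adj-profile X a b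
  cut-⊕ˡ e₂ X .adj-profile (inj₁ a) (inj₂ b) _ _   = refl
  cut-⊕ˡ e₂ X .adj-profile (inj₂ a) _ ()

  cut-⊕ʳ : ∀ e₁ {e₂ : Expr k} → Cut e₂ → Cut (e₁ ⊕ e₂)
  cut-⊕ʳ e₁ X .inside (inj₁ v)                     = false
  cut-⊕ʳ e₁ X .inside (inj₂ v)                     = inside X v
  cut-⊕ʳ e₁ X .class (inj₁ v)                      = label ⟦ e₁ ⟧ v
  cut-⊕ʳ e₁ X .class (inj₂ v)                      = class X v
  cut-⊕ʳ e₁ X .classLabel                          = classLabel X
  cut-⊕ʳ e₁ X .profile i (inj₁ v)                  = false
  cut-⊕ʳ e₁ X .profile i (inj₂ v)                  = profile X i v
  cut-⊕ʳ e₁ X .label-class (inj₁ a) ()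
  cut-⊕ʳ e₁ X .label-class (inj₂ a)                = label-class X a
  cut-⊕ʳ e₁ X .adj-profile (inj₁ a) _ ()
  cut-⊕ʳ e₁ X .adj-profile (inj₂ a) (inj₁ b) _ _   = refl
  cut-⊕ʳ e₁ X .adj-profile (inj₂ a) (inj₂ b)       = adj-profile X a b

  -- New edges depend only on the current labels of their ends, and `classLabel` computes the label
  -- of the inner end from its class. Profiles therefore remain functions of the class.
  cut-η : ∀ i j i≢j {e : Expr k} → Cut e → Cut (η i j i≢j e)
  cut-η i j i≢j X .inside      = inside X
  cut-η i j i≢j X .class       = class X
  cut-η i j i≢j X .classLabel  = classLabel X
  cut-η i j i≢j {e} X .profile c v = profile X c v ∨
    ((does (classLabel X c ≟ i) ∧ hasLabel ⟦ e ⟧ j v) ∨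
     (does (classLabel X c ≟ j) ∧ hasLabel ⟦ e ⟧ i v))
  cut-η i j i≢j X .label-class = label-class X
  cut-η i j i≢j {e} X .adj-profile a b a∈ b∉ = cong₂ _∨_ (adj-profile X a b a∈ b∉)
    (cong (λ l → (does (l ≟ i) ∧ hasLabel ⟦ e ⟧ j b) ∨ (does (l ≟ j) ∧ hasLabel ⟦ e ⟧ i b))
          (label-class X a a∈))

  cut-ρ : ∀ i j {e : Expr k} → Cut e → Cut (ρ i j e)
  cut-ρ i j X .inside           = inside X
  cut-ρ i j X .class            = class X
  cut-ρ i j X .classLabel c     =
    if does (classLabel X c ≟ i) then j else classLabel X c
  cut-ρ i j X .profile          = profile X
  cut-ρ i j X .label-class a a∈ =
    cong (λ l → if does (l ≟ i) then j else l) (label-class X a a∈)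
  cut-ρ i j X .adj-profile      = adj-profile X

  -- Counting vertices of an expression.

  count : (e : Expr k) → (Vertices e → Bool) → ℕ
  count (vertex _)  S = if S tt then 1 else 0
  count (e₁ ⊕ e₂)   S = count e₁ (S ∘ inj₁) + count e₂ (S ∘ inj₂)
  count (η _ _ _ e) S = count e S
  count (ρ _ _ e)   S = count e S

  count-∅ : ∀ e → count e (const false) ≡ 0
  count-∅ (vertex _)  = refl
  count-∅ (e₁ ⊕ e₂)   = cong₂ _+_ (count-∅ e₁) (count-∅ e₂)
  count-∅ (η _ _ _ e) = count-∅ e
  count-∅ (ρ _ _ e)   = count-∅ e

  count-split : ∀ e (T S : Vertices e → Bool) →
    count e (λ v → T v ∧ S v) + count e (λ v → not (T v) ∧ S v) ≡ count e S
  count-split (vertex _) T S with T tt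
  ... | true  = +-identityʳ _
  ... | false = refl
  count-split (e₁ ⊕ e₂) T S = trans
    (interchange (count e₁ (λ v → T (inj₁ v) ∧ S (inj₁ v))) _ _ _)
    (cong₂ _+_ (count-split e₁ (T ∘ inj₁) (S ∘ inj₁)) (count-split e₂ (T ∘ inj₂) (S ∘ inj₂)))
    where
    interchange : ∀ a b c d → (a + b) + (c + d) ≡ (a + c) + (b + d)
    interchange = solve-∀
  count-split (η _ _ _ e) = count-split e
  count-split (ρ _ _ e)   = count-split e

  count≥1 : ∀ e S v → S v ≡ true → 1 ≤ count e S
  count≥1 (vertex _)  S tt       v∈S rewrite v∈S = ≤-refl
  count≥1 (e₁ ⊕ e₂)   S (inj₁ v) v∈S = ≤-trans (count≥1 e₁ _ v v∈S) (m≤m+n _ _)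
  count≥1 (e₁ ⊕ e₂)   S (inj₂ v) v∈S = ≤-trans (count≥1 e₂ _ v v∈S) (m≤n+m _ _)
  count≥1 (η _ _ _ e) S v        v∈S = count≥1 e S v v∈S
  count≥1 (ρ _ _ e)   S v        v∈S = count≥1 e S v v∈S

  count≤1⇒≡ : ∀ e S u v → count e S ≤ 1 → S u ≡ true → S v ≡ true → u ≡ v
  count≤1⇒≡ (vertex _) S u v _ _ _ = refl
  count≤1⇒≡ (e₁ ⊕ e₂) S (inj₁ u) (inj₁ v) c≤1 u∈S v∈S =
    cong inj₁ (count≤1⇒≡ e₁ _ u v (≤-trans (m≤m+n _ _) c≤1) u∈S v∈S)
  count≤1⇒≡ (e₁ ⊕ e₂) S (inj₂ u) (inj₂ v) c≤1 u∈S v∈S =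
    cong inj₂ (count≤1⇒≡ e₂ _ u v (≤-trans (m≤n+m _ _) c≤1) u∈S v∈S)
  count≤1⇒≡ (e₁ ⊕ e₂) S (inj₁ u) (inj₂ v) c≤1 u∈S v∈S = contradiction c≤1
    (<⇒≱ (+-mono-≤ (count≥1 e₁ _ u u∈S) (count≥1 e₂ _ v v∈S)))
  count≤1⇒≡ (e₁ ⊕ e₂) S (inj₂ u) (inj₁ v) c≤1 u∈S v∈S = contradiction c≤1
    (<⇒≱ (+-mono-≤ (count≥1 e₁ _ v v∈S) (count≥1 e₂ _ u u∈S)))
  count≤1⇒≡ (η _ _ _ e) S = count≤1⇒≡ e S
  count≤1⇒≡ (ρ _ _ e)   S = count≤1⇒≡ e S

  -- Together with an isomorphism from a graph on `Fin n`, this identifies `count e (const true)`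
  -- with `n`.
  Vertices↔Fin : (e : Expr k) → Vertices e ↔ Fin (count e (const true))
  Vertices↔Fin (vertex _)  = ↔-sym 1↔⊤
  Vertices↔Fin (e₁ ⊕ e₂)   = ↔-sym +↔⊎ ↔-∘ (Vertices↔Fin e₁ ⊎-↔ Vertices↔Fin e₂)
  Vertices↔Fin (η _ _ _ e) = Vertices↔Fin e
  Vertices↔Fin (ρ _ _ e)   = Vertices↔Fin e

  -- Existence of balanced cuts.

  -- `s` is a parameter distinct from `count e S` because the descent into a subexpression keeps
  -- measuring against the total weight at the root.
  record BalancedCut (e : Expr k) (S : Vertices e → Bool) (s : ℕ) : Set where
    constructor balanced
    field
      cut   : Cut e
      lower : s ≤ 3 * count e (λ v → inside cut v ∧ S v)
      upper : 3 * count e (λ v → inside cut v ∧ S v) ≤ 2 * s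

  balancedCut-⊕ˡ : ∀ {e₁} e₂ {S s} → BalancedCut e₁ (S ∘ inj₁) s → BalancedCut (e₁ ⊕ e₂) S s
  balancedCut-⊕ˡ {e₁} e₂ {S} {s} (balanced X l u) = balanced (cut-⊕ˡ e₂ X)
    (≤-trans l (*-monoʳ-≤ 3 (≤-reflexive (sym same))))
    (≤-trans (*-monoʳ-≤ 3 (≤-reflexive same)) u)
    where
    same : count (e₁ ⊕ e₂) (λ v → inside (cut-⊕ˡ e₂ X) v ∧ S v)
         ≡ count e₁ (λ v → inside X v ∧ S (inj₁ v))
    same = trans (cong (count e₁ (λ v → inside X v ∧ S (inj₁ v)) +_) (count-∅ e₂)) (+-identityʳ _)

  balancedCut-⊕ʳ : ∀ e₁ {e₂ S s} → BalancedCut e₂ (S ∘ inj₂) s → BalancedCut (e₁ ⊕ e₂) S s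
  balancedCut-⊕ʳ e₁ {e₂} {S} {s} (balanced X l u) = balanced (cut-⊕ʳ e₁ X)
    (≤-trans l (*-monoʳ-≤ 3 (≤-reflexive (sym same))))
    (≤-trans (*-monoʳ-≤ 3 (≤-reflexive same)) u)
    where
    same : count (e₁ ⊕ e₂) (λ v → inside (cut-⊕ʳ e₁ X) v ∧ S v)
         ≡ count e₂ (λ v → inside X v ∧ S (inj₂ v))
    same = cong (_+ count e₂ (λ v → inside X v ∧ S (inj₂ v))) (count-∅ e₁)

  -- Descend while a child keeps more than 2/3 of the weight; where this stops,
  -- the heavier child of a union has between 1/3 and 2/3.
  balancedCut : ∀ e S s → 2 ≤ s → 2 * s < 3 * count e S → BalancedCut e S s
  balancedCut (vertex _) S s 2≤s 2s< with S tt
  -- A single vertex has weight 1, and 2s < 3 is impossible for s at least 2.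
  ... | true  = contradiction (≤-trans (s≤s (*-monoʳ-≤ 2 2≤s)) 2s<) λ { (s≤s (s≤s (s≤s ()))) }
  balancedCut (e₁ ⊕ e₂) S s 2≤s 2s<
    with 2 * s <? 3 * count e₁ (S ∘ inj₁) | 2 * s <? 3 * count e₂ (S ∘ inj₂)
  ... | yes p | _     = balancedCut-⊕ˡ e₂ (balancedCut e₁ _ s 2≤s p)
  ... | no _  | yes q = balancedCut-⊕ʳ e₁ (balancedCut e₂ _ s 2≤s q)
  ... | no p  | no q with ≤-total (count e₂ (S ∘ inj₂)) (count e₁ (S ∘ inj₁))
  ...   | inj₁ c₂≤c₁ = balancedCut-⊕ˡ e₂
          (balanced (whole e₁) (heavier-third s _ _ c₂≤c₁ 2s<) (≮⇒≥ p))
  ...   | inj₂ c₁≤c₂ = balancedCut-⊕ʳ e₁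
          (balanced (whole e₂)
            (heavier-third s (count e₂ (S ∘ inj₂)) (count e₁ (S ∘ inj₁)) c₁≤c₂
              (subst (λ c → 2 * s < 3 * c) (+-comm (count e₁ (S ∘ inj₁)) _) 2s<))
            (≮⇒≥ q))
  balancedCut (η i j i≢j e) S s 2≤s 2s< with balancedCut e S s 2≤s 2s<
  ... | balanced X l u = balanced (cut-η i j i≢j X) l u
  balancedCut (ρ i j e) S s 2≤s 2s< with balancedCut e S s 2≤s 2s<
  ... | balanced X l u = balanced (cut-ρ i j X) l u

-- Bit vectors and the decoder.

module _ {A : Set} where

  take-++ : ∀ {m n} (xs : Vec A m) (ys : Vec A n) → take m (xs ++ ys) ≡ xs
  take-++ []       ys = refl
  take-++ (x ∷ xs) ys = cong (x ∷_) (take-++ xs ys)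

  drop-++ : ∀ {m n} (xs : Vec A m) (ys : Vec A n) → drop m (xs ++ ys) ≡ ys
  drop-++ []       ys = refl
  drop-++ (x ∷ xs) ys = drop-++ xs ys

lookup-padRight : ∀ {A : Set} {m n} (m≤n : m ≤ n) (a : A) (xs : Vec A m) i →
                  lookup (padRight m≤n a xs) (inject≤ i m≤n) ≡ lookup xs i
lookup-padRight m≤n a xs i = trans
  (sym (lookup-truncate m≤n _ i)) (cong (λ ys → lookup ys i) (truncate-padRight m≤n a xs))

meets : ∀ {n} → Subset n → Subset n → Bool
meets p q = does (nonempty? (p ∩ q))

meets-comm : ∀ {n} (p q : Subset n) → meets p q ≡ meets q p
meets-comm p q = cong (does ∘ nonempty?) (∩-comm p q)

-- Intersecting with a singleton reads one bit. Since `meets` is symmetric, the decoder can query a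
-- profile without asking which of the two vertices is the inner one.
meets-⁅⁆ : ∀ {n} (i : Fin n) q → meets ⁅ i ⁆ q ≡ lookup q i
meets-⁅⁆ i q with lookup q i in eq
... | true  = dec-true (nonempty? (⁅ i ⁆ ∩ q))
                (i , x∈p∩q⁺ (x∈⁅x⁆ i , lookup⇒[]= i q eq))
... | false = dec-false (nonempty? (⁅ i ⁆ ∩ q)) λ (j , j∈) →
  let j∈⁅i⁆ , j∈q = x∈p∩q⁻ ⁅ i ⁆ q j∈
  in contradiction
       (trans (sym eq) ([]=⇒lookup (subst (_∈ q) (x∈⁅y⁆⇒x≡y i j∈⁅i⁆) j∈q))) λ ()

-- Each level is a side bit followed by `k` bits. Equal side bits lead into the common side; the
-- first difference identifies the cut that separates the two vertices.
decode : ∀ k D → Vec Bool (D * suc k) → Vec Bool (D * suc k) → Bool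
decode k zero    _       _       = false
decode k (suc D) (s ∷ x) (t ∷ y) =
  if does (s Bool.≟ t) then decode k D (drop k x) (drop k y)
                       else meets (take k x) (take k y)

-- A label never differs from itself in a side bit, so the recursion runs down to depth zero. This
-- makes constant labels correct wherever there are no edges.
decode-refl : ∀ k D x → decode k D x x ≡ false
decode-refl k zero    x       = refl
decode-refl k (suc D) (s ∷ x) rewrite dec-true (s Bool.≟ s) refl = decode-refl k D (drop k x)

decode-∷-++ : ∀ {k} D s t (p q : Subset k) x y →
  decode k (suc D) (s ∷ p ++ x) (t ∷ q ++ y) ≡
  (if does (s Bool.≟ t) then decode k D x y else meets p q)
decode-∷-++ D s t p q x y
  rewrite take-++ p x | take-++ q y | drop-++ p x | drop-++ q y = refl

-- Labels from iterated balanced cuts.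

module _ {c k : ℕ} (c≤k : c ≤ k) where

  -- Correctness is required only within `S`, so the two sides of a cut can be encoded
  -- independently. The decoder is fixed by `k`, while the expression has its own number `c` of
  -- labels.
  Encoding : (e : Expr c) (S : Vertices e → Bool) (D : ℕ) → Set
  Encoding e S D = Σ[ enc ∈ (Vertices e → Vec Bool (D * suc k)) ]
    (∀ u v → S u ≡ true → S v ≡ true →
      adj (graph ⟦ e ⟧) u v ≡ decode k D (enc u) (enc v))

  module _ {e : Expr c} (X : Cut e) where

    inner outer : Vertices e → Subset k
    inner v = ⁅ inject≤ (class X v) c≤k ⁆
    outer v = padRight c≤k false (tabulate (λ i → profile X i v))

    adj-across : ∀ u v → inside X u ≡ true → inside X v ≡ false →
                 adj (graph ⟦ e ⟧) u v ≡ meets (inner u) (outer v)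
    adj-across u v u∈ v∉ = begin
      adj (graph ⟦ e ⟧) u v                                ≡⟨ adj-profile X u v u∈ v∉ ⟩
      profile X i v                                        ≡⟨ lookup∘tabulate _ i ⟨
      lookup (tabulate (λ j → profile X j v)) i            ≡⟨ lookup-padRight c≤k false _ i ⟨
      lookup (outer v) (inject≤ i c≤k)                     ≡⟨ meets-⁅⁆ (inject≤ i c≤k) _ ⟨
      meets (inner u) (outer v)                            ∎
      where
      open ≡-Reasoning
      i = class X u

    combine : ∀ {S D} → Encoding e (λ v → inside X v ∧ S v) D →
              Encoding e (λ v → not (inside X v) ∧ S v) D → Encoding e S (suc D)
    combine {S} {D} (enc₁ , correct₁) (enc₂ , correct₂) =
      -- The side bits are separate arguments, with their equations, so that matching on them lets
      -- `code` compute.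
      (λ v → code (inside X v) v) , λ u v → cases u v (inside X u) (inside X v) refl refl
      where
      code : Bool → Vertices e → Vec Bool (suc D * suc k)
      code true  v = true  ∷ inner v ++ enc₁ v
      code false v = false ∷ outer v ++ enc₂ v

      member : ∀ {s t} → s ≡ true → t ≡ true → s ∧ t ≡ true
      member refl refl = refl

      cases : ∀ u v s t → inside X u ≡ s → inside X v ≡ t → S u ≡ true → S v ≡ true →
              adj (graph ⟦ e ⟧) u v ≡ decode k (suc D) (code s u) (code t v)
      cases u v true true u∈ v∈ u∈S v∈S = trans
        (correct₁ u v (member u∈ u∈S) (member v∈ v∈S))
        (sym (decode-∷-++ D true true (inner u) (inner v) _ _))
      cases u v false false u∉ v∉ u∈S v∈S = trans
        (correct₂ u v (member (cong not u∉) u∈S) (member (cong not v∉) v∈S))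
        (sym (decode-∷-++ D false false (outer u) (outer v) _ _))
      cases u v true false u∈ v∉ _ _ = trans
        (adj-across u v u∈ v∉)
        (sym (decode-∷-++ D true false (inner u) (outer v) _ _))
      cases u v false true u∉ v∈ _ _ = trans
        (trans (adj-sym (graph ⟦ e ⟧) u v)
          (trans (adj-across v u v∈ u∉) (meets-comm (inner v) (outer u))))
        (sym (decode-∷-++ D false true (outer u) (inner v) _ _))

  -- Within `S` only the pair of a vertex with itself occurs, and there are no loops. Arbitrary `D`
  -- pads branches that end early to the common length.
  trivialEncoding : ∀ e S D → count e S ≤ 1 → Encoding e S D
  trivialEncoding e S D c≤1 = const (replicate _ false) , λ u v u∈S v∈S → trans
    (trans (cong (adj (graph ⟦ e ⟧) u) (sym (count≤1⇒≡ e S u v c≤1 u∈S v∈S)))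
           (adj-irrefl (graph ⟦ e ⟧) u))
    (sym (decode-refl k D _))

  -- Every cut is a cut of the same `e`; only `S` shrinks. Both sides keep at most two thirds of
  -- `S`, so the bound passes to depth `D`, and at depth zero it leaves at most one vertex.
  encoding : ∀ e S D → count e S * 2 ^ D ≤ 3 ^ D → Encoding e S D
  encoding e S zero bound =
    trivialEncoding e S 0 (≤-trans (≤-reflexive (sym (*-identityʳ _))) bound)
  encoding e S (suc D) bound with count e S ≤? 1
  ... | yes c≤1 = trivialEncoding e S (suc D) c≤1
  ... | no  c≰1 = combine X {S = S}
      (encoding e _ D (two-thirds-power a s D upper bound))
      (encoding e _ D (two-thirds-power b s D
        (remaining-two-thirds a b s (count-split e (inside X) S) lower) bound))
    where
    s = count e S
    2≤s : 2 ≤ s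
    2≤s = ≰⇒> c≰1
    open BalancedCut (balancedCut e S s 2≤s
      (*-monoˡ-< s {{>-nonZero (≤-trans (s≤s z≤n) 2≤s)}} (≤-refl {3})))
      renaming (cut to X)
    a = count e (λ v → inside X v ∧ S v)
    b = count e (λ v → not (inside X v) ∧ S v)

-- Labels for graphs of bounded clique-width.

-- Only joins create edges, and a join needs two distinct labels.
edgeless : ∀ {c} → c ≤ 1 → (e : Expr c) → ∀ u v → adj (graph ⟦ e ⟧) u v ≡ false
edgeless c≤1 (vertex _) _ _              = refl
edgeless c≤1 (e₁ ⊕ e₂) (inj₁ u) (inj₁ v) = edgeless c≤1 e₁ u v
edgeless c≤1 (e₁ ⊕ e₂) (inj₂ u) (inj₂ v) = edgeless c≤1 e₂ u v
edgeless c≤1 (e₁ ⊕ e₂) (inj₁ u) (inj₂ v) = refl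
edgeless c≤1 (e₁ ⊕ e₂) (inj₂ u) (inj₁ v) = refl
edgeless (s≤s z≤n) (η zero zero i≢j e)   = contradiction refl i≢j
edgeless c≤1 (ρ _ _ e)                   = edgeless c≤1 e

-- For k ≤ 1 the size bound leaves no bits for H, whatever n is.
CliqueWidth-encoding : ∀ {k n} D → k ≤ 1 ⊎ n * 2 ^ D ≤ 3 ^ D →
  (H : Graph (Fin n)) → CliqueWidthAtMost k n H →
  Σ[ enc ∈ (Fin n → Vec Bool (D * suc k)) ] (∀ u v → adj H u v ≡ decode k D (enc u) (enc v))
CliqueWidth-encoding {k} D (inj₁ k≤1) H (c , ((e , f , iso) , _) , c≤k) =
  const (replicate _ false) , λ u v → trans
    (trans (sym (iso u v)) (edgeless (≤-trans c≤k k≤1) e _ _))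
    (sym (decode-refl k D _))
CliqueWidth-encoding D (inj₂ bound) H (c , ((e , f , iso) , _) , c≤k) =
  let enc , correct = encoding c≤k e (const true) D
        (subst (λ m → m * 2 ^ D ≤ 3 ^ D) (↔⇒≡ (Vertices↔Fin e ↔-∘ f)) bound)
  in enc ∘ Inverse.to f , λ u v →
       trans (sym (iso u v)) (correct (Inverse.to f u) (Inverse.to f v) refl refl)

-- Labels for probe graphs.

probeDecode : ∀ k D w → (x y : Vec Bool (w + D * suc k)) → Bool
probeDecode k D w x y = decode k D (drop w x) (drop w y) ∧ not (meets (take w x) (take w y))

-- The labels form a vector rather than a function, so that all candidates can be enumerated.
Labels : ∀ L n → (Vec Bool L → Vec Bool L → Bool) →
         Graph (Fin n) → Vec (Vec Bool L) n → Set
Labels L n dec G ls = ∀ u v → adj G u v ≡ dec (lookup ls u) (lookup ls v)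

probe-labels : ∀ {k n w} D → k ≤ 1 ⊎ n * 2 ^ D ≤ 3 ^ D → (G : Graph (Fin n)) →
  ProbeWitness (CliqueWidthAtMost k) G w → ∃[ ls ] Labels _ n (probeDecode k D w) G ls
probe-labels {k} {n} {w} D bound G W = tabulate enc , λ u v →
  subst₂ (λ x y → adj G u v ≡ probeDecode k D w x y)
    (sym (lookup∘tabulate enc u)) (sym (lookup∘tabulate enc v)) (correct u v)
  where
  open ProbeWitness W
  encᴴ = proj₁ (CliqueWidth-encoding D bound H H∈F)
  correctᴴ = proj₂ (CliqueWidth-encoding D bound H H∈F)

  memberships : Fin n → Subset w
  memberships v = tabulate (λ i → lookup (N i) v)

  enc : Fin n → Vec Bool (w + D * suc k)
  enc v = memberships v ++ encᴴ v

  ∈-memberships⁺ : ∀ {i v} → v ∈ N i → i ∈ memberships v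
  ∈-memberships⁺ {i} v∈ = lookup⇒[]= i _ (trans (lookup∘tabulate _ i) ([]=⇒lookup v∈))

  ∈-memberships⁻ : ∀ {i v} → i ∈ memberships v → v ∈ N i
  ∈-memberships⁻ {i} {v} i∈ =
    lookup⇒[]= v _ (trans (sym (lookup∘tabulate _ i)) ([]=⇒lookup i∈))

  -- Independence keeps the ends of an edge of `G` from sharing a set `N i`, while `covered` puts
  -- the ends of every additional edge of `H` into a common one.
  adj-probe : ∀ u v → adj G u v ≡ adj H u v ∧ not (meets (memberships u) (memberships v))
  adj-probe u v with adj G u v in uvG | adj H u v in uvH
  ... | true  | false = contradiction (trans (sym (subgraph u v uvG)) uvH) λ ()
  ... | false | false = refl
  ... | true  | true  = cong not (sym (dec-false (nonempty? _) λ (i , i∈) →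
    let i∈u , i∈v = x∈p∩q⁻ (memberships u) (memberships v) i∈
    in contradiction
         (trans (sym uvG) (independent i u v (∈-memberships⁻ i∈u) (∈-memberships⁻ i∈v))) λ ()))
  ... | false | true  = cong not (sym (dec-true (nonempty? _)
    (let i , u∈ , v∈ = covered u v uvH uvG
     in i , x∈p∩q⁺ (∈-memberships⁺ u∈ , ∈-memberships⁺ v∈))))

  correct : ∀ u v → adj G u v ≡ probeDecode k D w (enc u) (enc v)
  correct u v
    rewrite take-++ (memberships u) (encᴴ u) | take-++ (memberships v) (encᴴ v)
          | drop-++ (memberships u) (encᴴ u) | drop-++ (memberships v) (encᴴ v)
          = trans (adj-probe u v) (cong (_∧ _) (correctᴴ u v))

-- Exhaustive search for labels.

anyVec? : ∀ {A : Set} → (∀ {P : A → Set} → Decidable P → Dec (∃[ x ] P x)) →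
          ∀ n {P : Vec A n → Set} → Decidable P → Dec (∃[ xs ] P xs)
anyVec? any? zero    P? = map′ ([] ,_) (λ { ([] , p) → p }) (P? [])
anyVec? any? (suc n) P? =
  map′ (λ (x , xs , p) → x ∷ xs , p) (λ { (x ∷ xs , p) → x , xs , p })
       (any? λ x → anyVec? any? n λ xs → P? (x ∷ xs))

labels? : ∀ {L n} dec (G : Graph (Fin n)) → Dec (∃[ ls ] Labels L n dec G ls)
-- `Subset L` is `Vec Bool L`, so `anySubset?` searches the labels of a single vertex.
labels? dec G = anyVec? anySubset? _ λ ls → all? λ u → all? λ v →
  adj G u v Bool.≟ dec (lookup ls u) (lookup ls v)

-- Membership in the family is irrelevant to the encoder, so the labels are
-- recomputed by exhaustive search for the fixed decoder.
scheme : ∀ {L n} {F : Graph (Fin n) → Set} dec →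
  (∀ G → F G → ∃[ ls ] Labels L n dec G ls) → AdjacencyLabelingScheme L n F
scheme dec labels = record
  { enc     = λ G G∈F → lookup (proj₁ (recompute (labels? dec G) (labels G G∈F)))
  ; dec     = dec
  ; correct = λ G G∈F → proj₂ (recompute (labels? dec G) (labels G G∈F))
  }

-- Logarithms and the size bound.

floorLog₂ : ∀ n → 1 ≤ n → ∃[ m ] (2 ^ m ≤ n × n < 2 ^ suc m)
floorLog₂ 1             _ = 0 , ≤-refl , ≤-refl
floorLog₂ (suc (suc n)) _ with floorLog₂ (suc n) (s≤s z≤n)
... | m , 2^m≤ , n<2^ with suc (suc n) <? 2 ^ suc m
...   | yes lt = m , ≤-trans 2^m≤ (n≤1+n _) , lt
...   | no  ge = suc m , ≮⇒≥ ge ,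
          ≤-trans (s≤s n<2^) (^-monoʳ-< 2 ≤-refl (≤-refl {suc (suc m)}))

2^-cancel-≤ : ∀ {a b} → 2 ^ a ≤ 2 ^ b → a ≤ b
2^-cancel-≤ {a} {b} 2^a≤2^b = ≮⇒≥ λ b<a → <⇒≱ (^-monoʳ-< 2 ≤-refl b<a) 2^a≤2^b

-- An integer lower bound of log₂ n lies below each rational upper bound p / q: compare exponents in
-- 2^(mq) and 2^p.
log₂-lower : ∀ {m n p q} → 2 ^ m ≤ n → n ^ q ≤ 2 ^ p → m * q ≤ p
log₂-lower {m} {n} {p} {q} 2^m≤n n^q≤2^p = 2^-cancel-≤ (begin
  2 ^ (m * q)  ≡⟨ ^-*-assoc 2 m q ⟨
  (2 ^ m) ^ q  ≤⟨ ^-monoˡ-≤ q 2^m≤n ⟩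
  n ^ q        ≤⟨ n^q≤2^p ⟩
  2 ^ p        ∎)
  where open ≤-Reasoning

-- Two levels shrink the weight by 4/9, which is below one half, so 2m levels suffice for 2^m
-- vertices.
8^m≤9^m : ∀ m → 2 ^ m * 2 ^ (m * 2) ≤ 3 ^ (m * 2)
8^m≤9^m zero    = ≤-refl
8^m≤9^m (suc m) = begin
  (2 * 2 ^ m) * (2 * (2 * 2 ^ (m * 2))) ≡⟨ eight (2 ^ m) (2 ^ (m * 2)) ⟩
  8 * (2 ^ m * 2 ^ (m * 2))             ≤⟨ *-mono-≤ (n≤1+n 8) (8^m≤9^m m) ⟩
  9 * 3 ^ (m * 2)                       ≡⟨ *-assoc 3 3 (3 ^ (m * 2)) ⟩
  3 ^ (suc m * 2)                       ∎
  where
  open ≤-Reasoning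
  eight : ∀ x y → (2 * x) * (2 * (2 * y)) ≡ 8 * (x * y)
  eight = solve-∀

sizeBound-0 : ∀ k n w → SizeBound 8 k n w (w + 0)
sizeBound-0 k n w p q r s _ _ = begin
  (w + 0) * (q * s)                     ≡⟨ cong (_* (q * s)) (+-identityʳ w) ⟩
  w * (q * s)                           ≤⟨ m≤n+m _ (k * (p * r)) ⟩
  k * (p * r) + w * (q * s)             ≤⟨ m≤m+n _ _ ⟩
  8 * (k * (p * r) + w * (q * s))       ∎
  where open ≤-Reasoning

-- D ≤ 4 log₂ n and 1 + k ≤ 2 k log₂ k.
sizeBound-log : ∀ k n w m → 2 ≤ k → 1 ≤ m → 2 ^ m ≤ n →
                SizeBound 8 k n w (w + (suc m * 2) * suc k)
sizeBound-log k n w m 2≤k 1≤m 2^m≤n p q r s (_ , k^q≤2^p) (_ , n^s≤2^r) = begin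
  (w + (suc m * 2) * suc k) * (q * s)           ≡⟨ expand w m k q s ⟩
  (2 * (1 + m) * s) * ((1 + k) * q) + w * (q * s)
    ≤⟨ +-monoˡ-≤ (w * (q * s)) (*-mono-≤ levels bits) ⟩
  (4 * r) * (2 * k * p) + w * (q * s)
    ≤⟨ +-monoʳ-≤ ((4 * r) * (2 * k * p)) (m≤m+n (w * (q * s)) _) ⟩
  (4 * r) * (2 * k * p) + 8 * (w * (q * s))     ≡⟨ collect k p r (w * (q * s)) ⟩
  8 * (k * (p * r) + w * (q * s))               ∎
  where
  open ≤-Reasoning
  expand : ∀ w m k q s → (w + ((1 + m) * 2) * (1 + k)) * (q * s) ≡
           (2 * (1 + m) * s) * ((1 + k) * q) + w * (q * s)
  expand = solve-∀
  collect : ∀ k p r x → (4 * r) * (2 * k * p) + 8 * x ≡ 8 * (k * (p * r) + x)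
  collect = solve-∀
  regroup : ∀ m s → 2 * (m + m) * s ≡ 4 * (m * s)
  regroup = solve-∀
  q≤p : q ≤ p
  q≤p = subst (_≤ p) (+-identityʳ q) (log₂-lower {1} 2≤k k^q≤2^p)
  levels : 2 * (1 + m) * s ≤ 4 * r
  levels = begin
    2 * (1 + m) * s  ≤⟨ *-monoˡ-≤ s (*-monoʳ-≤ 2 (+-monoˡ-≤ m 1≤m)) ⟩
    2 * (m + m) * s  ≡⟨ regroup m s ⟩
    4 * (m * s)      ≤⟨ *-monoʳ-≤ 4 (log₂-lower {m} {p = r} 2^m≤n n^s≤2^r) ⟩
    4 * r            ∎
  bits : (1 + k) * q ≤ 2 * k * p
  bits = *-mono-≤ (begin
    1 + k        ≤⟨ +-monoˡ-≤ k (<⇒≤ 2≤k) ⟩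
    k + k        ≡⟨ cong (k +_) (+-identityʳ k) ⟨
    2 * k        ∎) q≤p

-- For `k` at most 1 or `n` equal to 1 the logarithmic term vanishes, and depth zero is chosen.
-- Otherwise `n` is below the power of two after its floor logarithm, and two levels are spent per
-- doubling.
depth : ∀ k n w → 1 ≤ n →
  ∃[ D ] ((k ≤ 1 ⊎ n * 2 ^ D ≤ 3 ^ D) × SizeBound 8 k n w (w + D * suc k))
depth k n w 1≤n with k ≤? 1 | floorLog₂ n 1≤n
... | yes k≤1 | _               = 0 , inj₁ k≤1 , sizeBound-0 k n w
... | no  _   | zero  , _ , n<2 =
      0 , inj₂ (subst (_≤ 1) (sym (*-identityʳ n)) (≤-pred n<2)) , sizeBound-0 k n w
... | no  k≰1 | suc m , 2^≤n , n<2^ =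
      suc (suc m) * 2 ,
      inj₂ (≤-trans (*-monoˡ-≤ (2 ^ (suc (suc m) * 2)) (<⇒≤ n<2^)) (8^m≤9^m (suc (suc m)))) ,
      sizeBound-log k n w (suc m) (≰⇒> k≰1) (s≤s z≤n) 2^≤n

corollary1 : ∃[ C ] (0 < C × (∀ (k w n : ℕ) → 1 ≤ k → 1 ≤ n →
    ∃[ L ] (SizeBound C k n w L ×
    AdjacencyLabelingScheme L n (ProbeGraph w (CliqueWidthAtMost k) n))))
-- The constant is the product of 4, from the depth, and 2, from the bits per level.
corollary1 = 8 , s≤s z≤n , λ k w n _ 1≤n →
  let D , bound , size = depth k n w 1≤n
  in w + D * suc k , size ,
     scheme (probeDecode k D w) λ G (W , _) → probe-labels D bound G W
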